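{- The width of the largest always graphic interval for $t$-uniform hypergraphic degree sequences goes to $0$ as $t\to\infty$. That is, if $w(t)$ denotes the supremum of $b-a$ over all always graphic intervals $[a,b]$ for $t$-uniformity, then $w(t)\to 0$ as $t\to\infty$.
   Context: A hypergraph $H=(V,E)$ is $t$-uniform if $E\subseteq\binom{V}{t}$; the degree $d(v)$ of a vertex is the number of hyperedges containing it. A degree sequence $D=(d_1,\dots,d_n)$ (of non-negative integers) has a $t$-uniform hypergraph realization if there is a $t$-uniform hypergraph on $v_1,\dots,v_n$ with $d(v_i)=d_i$ for all $i$. An interval $[a,b]$ with $0\le a\le b\le 1$ is an always graphic interval for $t$-uniformity if for all sufficiently large $n$, every degree sequence $D=(d_1,\dots,d_n)$ of length $n$ with $a\binom{n-1}{t-1}\le d_i\le b\binom{n-1}{t-1}$ for all $i$ and $\sum_i d_i\equiv 0\pmod t$ has a $t$-uniform hypergraph realization. Its width is $b-a$. -}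

module Defs where

open import Data.Fin using (Fin)
open import Data.Fin.Subset using (Subset; ∣_∣)
open import Data.Fin.Subset.Properties using (_∈?_)
open import Data.Integer using (+_)
open import Data.List using (List; length; filter)
open import Data.List.Relation.Unary.All using (All)
open import Data.List.Relation.Unary.Unique.Propositional using (Unique)
open import Data.Nat as ℕ using (ℕ; _∸_)
open import Data.Nat.Combinatorics using (_C_)
open import Data.Nat.Divisibility using (_∣_)
open import Data.Product using (∃; ∃₂; ∃-syntax; _×_; _,_)
open import Data.Rational using (ℚ; 0ℚ; 1ℚ; ½; _/_; _+_; _-_; -_; _*_; _<_; 1/_; Positive; NonNegative; NonZero)
open import Data.Rational.Properties
open import Data.Rational.Solver using (module +-*-Solver)
open import Data.Vec using (Vec; lookup; sum)
open import Relation.Binary.PropositionalEquality using (_≡_; refl; sym; trans; cong; subst)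
open import Relation.Nullary using (¬_)

------------------------------------------------------------------------
-- Real numbers

-- Two-sided Dedekind cuts.  `located` is the arithmetic form of
-- locatedness; it implies that both halves of the cut are inhabited.
record ℝ : Set₁ where
  field
    Lower     : ℚ → Set
    Upper     : ℚ → Set
    down      : ∀ {p q} → p < q → Lower q → Lower p
    up        : ∀ {p q} → p < q → Upper p → Upper q
    lowerOpen : ∀ {p} → Lower p → ∃[ q ] p < q × Lower q
    upperOpen : ∀ {q} → Upper q → ∃[ p ] p < q × Upper p
    separated : ∀ {p q} → Lower p → Upper q → p < q
    located   : ∀ ε → 0ℚ < ε → ∃[ q ] Lower q × Upper (q + ε)

open ℝ public

infix 4 _≤ᴿ_

_≤ᴿ_ : ℝ → ℝ → Set
x ≤ᴿ y = ∀ q → Lower x q → Lower y q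

private
  x<x+δ : ∀ x {δ} → 0ℚ < δ → x < x + δ
  x<x+δ x {δ} 0<δ = subst (_< x + δ) (+-identityʳ x) (+-monoʳ-< x {0ℚ} {δ} 0<δ)

  x-δ<x : ∀ x {δ} → 0ℚ < δ → x - δ < x
  x-δ<x x {δ} 0<δ = subst (x - δ <_) (+-identityʳ x)
    (+-monoʳ-< x { - δ} {0ℚ} (neg-antimono-< {0ℚ} {δ} 0<δ))

  scale-pos : ∀ {ε} c .{{_ : Positive c}} → 0ℚ < ε → 0ℚ < ε * c
  scale-pos {ε} c 0<ε = subst (_< ε * c) (*-zeroˡ c) (*-monoˡ-<-pos c 0<ε)

fromℚ : ℚ → ℝ
fromℚ p = record
  { Lower     = _< p
  ; Upper     = p <_
  ; down      = <-trans
  ; up        = λ p<q r<p → <-trans r<p p<q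
  ; lowerOpen = λ q<p → let (m , q<m , m<p) = <-dense q<p in m , q<m , m<p
  ; upperOpen = λ p<q → let (m , p<m , m<q) = <-dense p<q in m , m<q , p<m
  ; separated = <-trans
  ; located   = λ ε 0<ε → let 0<δ = scale-pos ½ 0<ε in
      p - ε * ½ , x-δ<x p 0<δ , subst (p <_) (sym (eq p ε)) (x<x+δ p 0<δ)
  }
  where
  open +-*-Solver
  eq : ∀ p ε → p - ε * ½ + ε ≡ p + ε * ½
  eq = solve 2 (λ p ε → p :- ε :* con ½ :+ ε := p :+ ε :* con ½) refl

ℕ→ℚ : ℕ → ℚ
ℕ→ℚ n = + n / 1

fromℕ : ℕ → ℝ
fromℕ n = fromℚ (ℕ→ℚ n)

infixl 6 _-ᴿ_

_-ᴿ_ : ℝ → ℝ → ℝ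
x -ᴿ y = record
  { Lower     = λ q → ∃₂ λ r s → Lower x r × Upper y s × q < r - s
  ; Upper     = λ q → ∃₂ λ r s → Upper x r × Lower y s × r - s < q
  ; down      = λ p<q (r , s , xr , ys , q<) → r , s , xr , ys , <-trans p<q q<
  ; up        = λ p<q (r , s , xr , ys , <p) → r , s , xr , ys , <-trans <p p<q
  ; lowerOpen = λ (r , s , xr , ys , q<) → let (m , q<m , m<) = <-dense q< in
      m , q<m , r , s , xr , ys , m<
  ; upperOpen = λ (r , s , xr , ys , <q) → let (m , <m , m<q) = <-dense <q in
      m , m<q , r , s , xr , ys , <m
  ; separated = λ (r , s , xr , ys , p<) (r′ , s′ , xr′ , ys′ , <q) →
      <-trans p< (<-trans (+-mono-< (separated x xr xr′)
                                    (neg-antimono-< (separated y ys′ ys))) <q)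
  ; located   = λ ε 0<ε →
      let δ              = ε * (½ * ½)
          0<δ            = scale-pos (½ * ½) 0<ε
          (r , xr , xr′) = located x δ 0<δ
          (s , ys , ys′) = located y δ 0<δ
      in r - (s + δ) - δ
       , (r , s + δ , xr , ys′ , x-δ<x (r - (s + δ)) 0<δ)
       , (r + δ , s , xr′ , ys
         , subst (r + δ - s <_) (sym (eq r s ε)) (x<x+δ (r + δ - s) 0<δ))
  }
  where
  open +-*-Solver
  eq : ∀ r s ε → r - (s + ε * (½ * ½)) - ε * (½ * ½) + ε
               ≡ r + ε * (½ * ½) - s + ε * (½ * ½)
  eq = solve 3 (λ r s ε → let δ = ε :* con (½ * ½) in
         r :- (s :+ δ) :- δ :+ ε := r :+ δ :- s :+ δ) refl

infixl 7 _·_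

_·_ : ℝ → ℕ → ℝ
x · n = record
  { Lower     = λ q → ∃[ r ] Lower x r × q < r * c
  ; Upper     = λ q → ∃[ r ] Upper x r × r * c < q
  ; down      = λ p<q (r , xr , q<) → r , xr , <-trans p<q q<
  ; up        = λ p<q (r , xr , <p) → r , xr , <-trans <p p<q
  ; lowerOpen = λ (r , xr , q<) → let (m , q<m , m<) = <-dense q< in
      m , q<m , r , xr , m<
  ; upperOpen = λ (r , xr , <q) → let (m , <m , m<q) = <-dense <q in
      m , m<q , r , xr , <m
  ; separated = λ (r , xr , p<) (r′ , xr′ , <q) →
      <-trans (<-≤-trans p< (*-monoʳ-≤-nonNeg c (<⇒≤ (separated x xr xr′)))) <q
  ; located   = λ ε 0<ε →
      let δ              = ε * 1/ d
          0<δ            = scale-pos (1/ d) {{1/pos⇒pos d}} 0<ε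
          (r , xr , xr′) = located x δ 0<δ
      in r * c - δ
       , (r , xr , x-δ<x (r * c) 0<δ)
       , (r + δ , xr′ , subst ((r + δ) * c <_) (eq′ r ε) (x<x+δ ((r + δ) * c) 0<δ))
  }
  where
  open +-*-Solver

  c : ℚ
  c = ℕ→ℚ n

  instance
    c≥0 : NonNegative c
    c≥0 = normalize-nonNeg n 1

  d : ℚ
  d = c + (1ℚ + 1ℚ)

  instance
    d>0 : Positive d
    d>0 = nonNeg+pos⇒pos c (1ℚ + 1ℚ)
    d≢0 : NonZero d
    d≢0 = pos⇒nonZero d

  eq : ∀ r δ c → (r + δ) * c + δ ≡ r * c - δ + δ * (c + (1ℚ + 1ℚ))
  eq = solve 3 (λ r δ c →
         (r :+ δ) :* c :+ δ := r :* c :- δ :+ δ :* (c :+ con (1ℚ + 1ℚ))) refl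

  cancel : ∀ ε → ε * 1/ d * d ≡ ε
  cancel ε = trans (*-assoc ε (1/ d) d)
                   (trans (cong (ε *_) (*-inverseˡ d)) (*-identityʳ ε))

  eq′ : ∀ r ε → (r + ε * 1/ d) * c + ε * 1/ d ≡ r * c - ε * 1/ d + ε
  eq′ r ε = trans (eq r (ε * 1/ d) c) (cong (λ z → r * c - ε * 1/ d + z) (cancel ε))

-- Suprema are formed as left cuts, i.e. sets of rationals: the union of the
-- lower halves.  Constructively a supremum need not be located, so it need
-- not be an element of ℝ.  The supremum of an empty (unbounded) family
-- is the empty (full) left cut.
LeftCut : Set₂
LeftCut = ℚ → Set₁

sup : {I : Set₁} → (I → ℝ) → LeftCut
sup x q = ∃[ i ] Lower (x i) q

-- For a left cut w, `w (- ε)` says - ε < w and `¬ w ε` says w ≤ ε.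
TendsToZero : (ℕ → LeftCut) → Set₁
TendsToZero w =
  ∀ ε → 0ℚ < ε → ∃[ T ] ∀ t → T ℕ.≤ t → w t (- ε) × ¬ w t ε

------------------------------------------------------------------------
-- Hypergraphs

record UniformHypergraph (t n : ℕ) : Set where
  field
    edges   : List (Subset n)
    unique  : Unique edges
    uniform : All (λ e → ∣ e ∣ ≡ t) edges

  degree : Fin n → ℕ
  degree v = length (filter (v ∈?_) edges)

open UniformHypergraph public using (degree)

HasRealization : (t : ℕ) {n : ℕ} → Vec ℕ n → Set
HasRealization t {n} D =
  ∃ λ (H : UniformHypergraph t n) → ∀ i → degree H i ≡ lookup D i

-- The truncated subtractions matter only when n = 0 or t = 0, which the
-- asymptotic regimes n → ∞ and t → ∞ ignore.
maxDegree : (t n : ℕ) → ℕ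
maxDegree t n = (n ∸ 1) C (t ∸ 1)

record AlwaysGraphicInterval (t : ℕ) : Set₁ where
  field
    a b           : ℝ
    0≤a           : fromℕ 0 ≤ᴿ a
    a≤b           : a ≤ᴿ b
    b≤1           : b ≤ᴿ fromℕ 1
    alwaysGraphic : ∃[ N ] ∀ n → N ℕ.≤ n → (D : Vec ℕ n) →
      (∀ i → a · maxDegree t n ≤ᴿ fromℕ (lookup D i)
           × fromℕ (lookup D i) ≤ᴿ b · maxDegree t n) →
      t ∣ sum D →
      HasRealization t D

  width : ℝ
  width = b -ᴿ a

maxWidth : ℕ → LeftCut
maxWidth t = sup (AlwaysGraphicInterval.width {t})

{-# OPTIONS --safe #-}

-- On 2h vertices let the degrees alternate between l + d and l.  Call the number
-- of high vertices of an edge minus the number of its low ones its imbalance; in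
-- a realization the imbalances of the edges sum to h d.  Over all t-subsets,
-- however, the squares of the imbalances sum to at most t C(2h, t): typical
-- imbalances are of order √t only.  Summing 2 L y ≤ y² + L² over the imbalances y of the edges
-- gives 2 L h d ≤ (t + L²) C(2h, t), that is L d ≤ 2 C(2h-1, t-1) once L² ≤ t.
-- An always graphic interval wider than ε would permit d ≈ ε C(2h-1, t-1),
-- which is impossible for L > 2/ε.

module Submission where

open import Defs
open import Data.Bool using (true; false)
open import Data.Fin using (Fin; zero; suc)
open import Data.Fin.Subset using (Subset; inside; outside; ∣_∣)
open import Data.Fin.Subset.Properties using (_∈?_)
open import Data.Integer as ℤ using (ℤ; +_; -[1+_]; +[1+_]; +0; 0ℤ; 1ℤ; -1ℤ)
import Data.Integer.Properties as ℤₚ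
import Data.Integer.Tactic.RingSolver as ℤ-Ring
open import Data.List using (List; []; _∷_; _++_; map; length; filter)
open import Data.List.Membership.Propositional using (_∈_)
open import Data.List.Membership.Propositional.Properties using (∈-map⁺; ∈-++⁺ˡ; ∈-++⁺ʳ; ∈-++⁻; ∈-∃++)
open import Data.List.Properties using (map-++; map-∘; length-++; length-map; filter-++)
open import Data.List.Relation.Unary.All as All using ([])
open import Data.List.Relation.Unary.AllPairs using ([]; _∷_)
open import Data.List.Relation.Unary.Any using (here; there)
open import Data.List.Relation.Unary.Unique.Propositional using (Unique)
open import Data.Nat using (ℕ; zero; suc; _+_; _*_; _∸_; _≤_; _<_; z≤n; s≤s)
open import Data.Nat.Combinatorics using (_C_; nCn≡1; nCk≡nC[n∸k]; nCk+nC[k+1]≡[n+1]C[k+1])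
open import Data.Nat.Divisibility using (_∣_; ∣m⇒∣m*n; m∣m*n)
open import Data.Nat.ListAction using (sum)
open import Data.Nat.ListAction.Properties using (sum-++)
open import Data.Nat.Properties
open import Data.Nat.Tactic.RingSolver using (solve-∀)
open import Data.Product using (_,_; _×_; ∃; ∃₂; proj₁; proj₂)
open import Data.Rational as ℚ using (ℚ; mkℚ; 0ℚ; 1ℚ; *≤*; *<*)
open import Data.Rational.Literals using (fromℤ)
import Data.Rational.Properties as ℚₚ
import Data.Rational.Solver as ℚ-Solver
open import Data.Rational.Unnormalised using (mkℚᵘ; *≡*)
open import Data.Sum using (inj₁; inj₂)
open import Data.Vec as Vec using (Vec; []; _∷_; lookup)
open import Function using (_∘_)
open import Relation.Binary.PropositionalEquality
open import Relation.Nullary using (¬_; contradiction; does; yes; no)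

-- Binomial coefficients

nC0≡1 : ∀ n → n C 0 ≡ 1
nC0≡1 n = trans (nCk≡nC[n∸k] {0} {n} z≤n) (nCn≡1 n)

nCk>0 : ∀ k j → 1 ≤ (k + j) C k
nCk>0 zero    j = ≤-reflexive (sym (nC0≡1 j))
nCk>0 (suc k) j = begin
  1                                  ≤⟨ nCk>0 k j ⟩
  (k + j) C k                        ≤⟨ m≤m+n _ _ ⟩
  (k + j) C k + (k + j) C suc k      ≡⟨ nCk+nC[k+1]≡[n+1]C[k+1] (k + j) k ⟩
  suc (k + j) C suc k                ∎
  where open ≤-Reasoning

-- By Pascal's rule each increment of `j` adds a binomial that is at least 1. This lets the maximum
-- degree exceed any bound as the number of vertices grows.
nC[k+1]-grows : ∀ k j → j < (suc k + j) C suc k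
nC[k+1]-grows k zero    = nCk>0 (suc k) 0
nC[k+1]-grows k (suc j) = begin
  1 + suc j                                  ≤⟨ +-mono-≤ (nCk>0 k (suc j)) (nC[k+1]-grows k j) ⟩
  (k + suc j) C k + (suc k + j) C suc k      ≡⟨ cong (λ m → (k + suc j) C k + m C suc k) (+-suc k j) ⟨
  (k + suc j) C k + (k + suc j) C suc k      ≡⟨ nCk+nC[k+1]≡[n+1]C[k+1] (k + suc j) k ⟩
  suc (k + suc j) C suc k                    ∎
  where open ≤-Reasoning

-- Absorption: both sides count subsets with a marked element. It later converts `t` times the
-- number of t-subsets into the number of vertices times `maxDegree`.
k*nCk≡n*[n-1]C[k-1] : ∀ n k → suc k * (suc n C suc k) ≡ suc n * (n C k)
k*nCk≡n*[n-1]C[k-1] zero    zero    = refl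
k*nCk≡n*[n-1]C[k-1] zero    (suc k) = *-zeroʳ k
k*nCk≡n*[n-1]C[k-1] (suc n) zero    = begin
  1 * (suc (suc n) C 1)               ≡⟨ cong (1 *_) (nCk+nC[k+1]≡[n+1]C[k+1] (suc n) 0) ⟨
  1 * (suc n C 0 + suc n C 1)         ≡⟨ *-distribˡ-+ 1 (suc n C 0) _ ⟩
  1 * (suc n C 0) + 1 * (suc n C 1)   ≡⟨ cong₂ _+_ (cong (1 *_) (nC0≡1 (suc n))) (k*nCk≡n*[n-1]C[k-1] n 0) ⟩
  1 * 1 + suc n * (n C 0)             ≡⟨ cong (λ m → 1 * 1 + suc n * m) (nC0≡1 n) ⟩
  suc (suc n) * 1                     ≡⟨ cong (suc (suc n) *_) (nC0≡1 (suc n)) ⟨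
  suc (suc n) * (suc n C 0)           ∎
  where open ≡-Reasoning
k*nCk≡n*[n-1]C[k-1] (suc n) (suc k) = begin
  (2 + k) * (suc (suc n) C (2 + k))      ≡⟨ cong ((2 + k) *_) (nCk+nC[k+1]≡[n+1]C[k+1] (suc n) (suc k)) ⟨
  -- Setting one `A` apart leaves the coefficients `suc k` and `2 + k` that the two induction
  -- hypotheses need.
  (2 + k) * (A + B)                      ≡⟨ split k A B ⟩
  A + (suc k * A + (2 + k) * B)          ≡⟨ cong (λ z → A + z) (cong₂ _+_ (k*nCk≡n*[n-1]C[k-1] n k) (k*nCk≡n*[n-1]C[k-1] n (suc k))) ⟩
  A + (suc n * (n C k) + suc n * (n C suc k)) ≡⟨ cong (λ z → A + z) (*-distribˡ-+ (suc n) (n C k) _) ⟨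
  A + suc n * (n C k + n C suc k)        ≡⟨ cong (λ m → A + suc n * m) (nCk+nC[k+1]≡[n+1]C[k+1] n k) ⟩
  (2 + n) * A                            ∎
  where
  open ≡-Reasoning
  A = suc n C suc k
  B = suc n C (2 + k)
  split : ∀ k a b → (2 + k) * (a + b) ≡ a + (suc k * a + (2 + k) * b)
  split = solve-∀

-- Sums over the t-subsets of a finite set

subsets : ∀ n (t : ℕ) → List (Subset n)
subsets zero    zero    = [] ∷ []
subsets zero    (suc t) = []
subsets (suc n) zero    = map (outside ∷_) (subsets n zero)
subsets (suc n) (suc t) = map (inside ∷_) (subsets n t) ++ map (outside ∷_) (subsets n (suc t))

∈-subsets : ∀ {n} (e : Subset n) → e ∈ subsets n ∣ e ∣
∈-subsets []            = here refl
∈-subsets (inside ∷ e)  = ∈-++⁺ˡ (∈-map⁺ (inside ∷_) (∈-subsets e))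
∈-subsets (outside ∷ e) with ∣ e ∣ | ∈-subsets e
... | zero  | e∈ = ∈-map⁺ (outside ∷_) e∈
... | suc t | e∈ = ∈-++⁺ʳ (map (inside ∷_) (subsets _ t)) (∈-map⁺ (outside ∷_) e∈)

length-subsets : ∀ n t → length (subsets n t) ≡ n C t
length-subsets zero    zero    = refl
length-subsets zero    (suc t) = refl
length-subsets (suc n) zero    = begin
  length (map (outside ∷_) (subsets n 0))  ≡⟨ length-map (outside ∷_) (subsets n 0) ⟩
  length (subsets n 0)                     ≡⟨ length-subsets n 0 ⟩
  n C 0                                    ≡⟨ trans (nC0≡1 n) (sym (nC0≡1 (suc n))) ⟩
  suc n C 0                                ∎
  where open ≡-Reasoning
length-subsets (suc n) (suc t) = begin
  length (map (inside ∷_) (subsets n t) ++ map (outside ∷_) (subsets n (suc t)))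
    ≡⟨ length-++ (map (inside ∷_) (subsets n t)) ⟩
  length (map (inside ∷_) (subsets n t)) + length (map (outside ∷_) (subsets n (suc t)))
    ≡⟨ cong₂ _+_ (trans (length-map _ (subsets n t)) (length-subsets n t))
                 (trans (length-map _ (subsets n (suc t))) (length-subsets n (suc t))) ⟩
  n C t + n C suc t
    ≡⟨ nCk+nC[k+1]≡[n+1]C[k+1] n t ⟩
  suc n C suc t ∎
  where open ≡-Reasoning

sum-map-++ : ∀ {A : Set} (f : A → ℕ) xs ys → sum (map f (xs ++ ys)) ≡ sum (map f xs) + sum (map f ys)
sum-map-++ f xs ys = trans (cong sum (map-++ f xs ys)) (sum-++ (map f xs) (map f ys))

-- The head `x` is cut out of `ys` at one occurrence; since `xs` has no repetitions, its tail still
-- lies in the rest. Whatever is left of `ys` at the end only adds nonnegative terms.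
sum-map-⊆ : ∀ {A : Set} (f : A → ℕ) {xs ys : List A} → Unique xs → (∀ {x} → x ∈ xs → x ∈ ys) →
            sum (map f xs) ≤ sum (map f ys)
sum-map-⊆ f {[]}     []          xs⊆ys = z≤n
sum-map-⊆ f {x ∷ xs} (x∉xs ∷ xs!) xs⊆ys with ∈-∃++ (xs⊆ys (here refl))
... | us , vs , refl = begin
  f x + sum (map f xs)                        ≤⟨ +-monoʳ-≤ (f x) (sum-map-⊆ f xs! avoids-x) ⟩
  f x + sum (map f (us ++ vs))                ≡⟨ cong (λ z → f x + z) (sum-map-++ f us vs) ⟩
  f x + (sum (map f us) + sum (map f vs))     ≡⟨ swap (f x) (sum (map f us)) _ ⟩
  sum (map f us) + (f x + sum (map f vs))     ≡⟨ sum-map-++ f us (x ∷ vs) ⟨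
  sum (map f (us ++ x ∷ vs))                  ∎
  where
  open ≤-Reasoning
  swap : ∀ a b c → a + (b + c) ≡ b + (a + c)
  swap = solve-∀
  avoids-x : ∀ {y} → y ∈ xs → y ∈ us ++ vs
  avoids-x y∈xs with ∈-++⁻ us (xs⊆ys (there y∈xs))
  ... | inj₁ y∈us         = ∈-++⁺ˡ y∈us
  ... | inj₂ (here refl)  = contradiction refl (All.lookup x∉xs y∈xs)
  ... | inj₂ (there y∈vs) = ∈-++⁺ʳ us y∈vs

sum-map-+-const : ∀ {A : Set} (f : A → ℕ) c xs → sum (map (λ x → f x + c) xs) ≡ sum (map f xs) + length xs * c
sum-map-+-const f c []       = refl
sum-map-+-const f c (x ∷ xs) = begin
  f x + c + sum (map (λ x → f x + c) xs)        ≡⟨ cong (λ z → f x + c + z) (sum-map-+-const f c xs) ⟩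
  f x + c + (sum (map f xs) + length xs * c)    ≡⟨ interchange (f x) c (sum (map f xs)) _ ⟩
  f x + sum (map f xs) + (c + length xs * c)    ∎
  where
  open ≡-Reasoning
  interchange : ∀ a b c d → a + b + (c + d) ≡ a + c + (b + d)
  interchange = solve-∀

-- The second moment of the imbalance

-- The number of elements of e at even positions minus the number at odd positions.
imbalance : ∀ h → Subset (h * 2) → ℤ
imbalance zero    []                      = 0ℤ
imbalance (suc h) (inside  ∷ inside  ∷ e) = imbalance h e
imbalance (suc h) (inside  ∷ outside ∷ e) = 1ℤ ℤ.+ imbalance h e
imbalance (suc h) (outside ∷ inside  ∷ e) = -1ℤ ℤ.+ imbalance h e
imbalance (suc h) (outside ∷ outside ∷ e) = imbalance h e

-- Squares live in `ℕ`, so that a sum over edges can be enlarged to all t-subsets by `sum-map-⊆`.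
sq : ℤ → ℕ
sq i = ℤ.∣ i ∣ * ℤ.∣ i ∣

+sq : ∀ i → + sq i ≡ i ℤ.* i
+sq (+ n)    = ℤₚ.pos-* n n
+sq -[1+ n ] = refl

parallelogram : ∀ i → sq (1ℤ ℤ.+ i) + sq (-1ℤ ℤ.+ i) ≡ 2 * sq i + 2
parallelogram i = ℤₚ.+-injective (begin
  + (sq (1ℤ ℤ.+ i) + sq (-1ℤ ℤ.+ i))                            ≡⟨ ℤₚ.pos-+ (sq (1ℤ ℤ.+ i)) _ ⟩
  + sq (1ℤ ℤ.+ i) ℤ.+ + sq (-1ℤ ℤ.+ i)                          ≡⟨ cong₂ ℤ._+_ (+sq (1ℤ ℤ.+ i)) (+sq (-1ℤ ℤ.+ i)) ⟩
  (1ℤ ℤ.+ i) ℤ.* (1ℤ ℤ.+ i) ℤ.+ (-1ℤ ℤ.+ i) ℤ.* (-1ℤ ℤ.+ i)     ≡⟨ expand i ⟩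
  + 2 ℤ.* (i ℤ.* i) ℤ.+ + 2                                     ≡⟨ cong (λ j → + 2 ℤ.* j ℤ.+ + 2) (+sq i) ⟨
  + 2 ℤ.* + sq i ℤ.+ + 2                                        ≡⟨ cong (ℤ._+ + 2) (ℤₚ.pos-* 2 (sq i)) ⟨
  + (2 * sq i) ℤ.+ + 2                                          ≡⟨ ℤₚ.pos-+ (2 * sq i) 2 ⟨
  + (2 * sq i + 2)                                              ∎)
  where
  open ≡-Reasoning
  expand : ∀ i → (1ℤ ℤ.+ i) ℤ.* (1ℤ ℤ.+ i) ℤ.+ (-1ℤ ℤ.+ i) ℤ.* (-1ℤ ℤ.+ i) ≡ + 2 ℤ.* (i ℤ.* i) ℤ.+ + 2
  expand = ℤ-Ring.solve-∀

∑ : ∀ n t → (Subset n → ℕ) → ℕ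
∑ n t f = sum (map f (subsets n t))

∑-zero : ∀ n f → ∑ (suc n) 0 f ≡ ∑ n 0 (f ∘ (outside ∷_))
∑-zero n f = cong sum (sym (map-∘ (subsets n 0)))

∑-suc : ∀ n t f → ∑ (suc n) (suc t) f ≡ ∑ n t (f ∘ (inside ∷_)) + ∑ n (suc t) (f ∘ (outside ∷_))
∑-suc n t f = trans (sum-map-++ f (map (inside ∷_) (subsets n t)) _)
                    (cong₂ _+_ (cong sum (sym (map-∘ (subsets n t)))) (cong sum (sym (map-∘ (subsets n (suc t))))))

energy : ∀ h → Subset (h * 2) → ℕ
energy h e = sq (imbalance h e)

sum-parallelogram : ∀ h (es : List (Subset (h * 2))) →
  sum (map (λ e → sq (1ℤ ℤ.+ imbalance h e)) es) + sum (map (λ e → sq (-1ℤ ℤ.+ imbalance h e)) es)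
    ≡ 2 * sum (map (energy h) es) + length es * 2
sum-parallelogram h []       = refl
sum-parallelogram h (e ∷ es) = begin
  a + A + (b + B)                             ≡⟨ interchange a A b B ⟩
  a + b + (A + B)                             ≡⟨ cong₂ _+_ (parallelogram (imbalance h e)) (sum-parallelogram h es) ⟩
  2 * c + 2 + (2 * C′ + length es * 2)        ≡⟨ regroup c C′ (length es * 2) ⟩
  2 * (c + C′) + (2 + length es * 2)          ∎
  where
  open ≡-Reasoning
  a = sq (1ℤ ℤ.+ imbalance h e)
  b = sq (-1ℤ ℤ.+ imbalance h e)
  c = energy h e
  A = sum (map (λ e → sq (1ℤ ℤ.+ imbalance h e)) es)
  B = sum (map (λ e → sq (-1ℤ ℤ.+ imbalance h e)) es)
  C′ = sum (map (energy h) es)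
  interchange : ∀ a b c d → a + b + (c + d) ≡ a + c + (b + d)
  interchange = solve-∀
  regroup : ∀ c d e → 2 * c + 2 + (2 * d + e) ≡ 2 * (c + d) + (2 + e)
  regroup = solve-∀

-- The induction splits off a pair of one high and one low vertex.  The t-subsets
-- that contain exactly one of them contribute (1 + y)² + (-1 + y)² = 2 y² + 2, so
-- that no first moments have to be computed.
∑-energy≤ : ∀ h t → ∑ (h * 2) t (energy h) ≤ t * ((h * 2) C t)
∑-energy≤ zero    zero    = z≤n
∑-energy≤ zero    (suc t) = z≤n
∑-energy≤ (suc h) zero    = begin
  ∑ (2 + h * 2) 0 (energy (suc h))                     ≡⟨ ∑-zero (1 + h * 2) _ ⟩
  ∑ (1 + h * 2) 0 (energy (suc h) ∘ (outside ∷_))      ≡⟨ ∑-zero (h * 2) _ ⟩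
  ∑ (h * 2) 0 (energy h)                               ≤⟨ ∑-energy≤ h 0 ⟩
  0                                                    ∎
  where open ≤-Reasoning
-- A one-element subset cannot contain both vertices of the pair, so this case has one term fewer
-- than the general one.
∑-energy≤ (suc h) (suc zero) = begin
  ∑ (2 + m) 1 (energy (suc h))
    ≡⟨ trans (∑-suc (1 + m) 0 _) (cong₂ _+_ (∑-zero m _) (∑-suc m 0 _)) ⟩
  ∑ m 0 (λ e → sq (1ℤ ℤ.+ imbalance h e)) + (∑ m 0 (λ e → sq (-1ℤ ℤ.+ imbalance h e)) + ∑ m 1 (energy h))
    ≡⟨ +-assoc (∑ m 0 _) _ _ ⟨
  ∑ m 0 (λ e → sq (1ℤ ℤ.+ imbalance h e)) + ∑ m 0 (λ e → sq (-1ℤ ℤ.+ imbalance h e)) + ∑ m 1 (energy h)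
    ≡⟨ cong (_+ ∑ m 1 (energy h)) (sum-parallelogram h (subsets m 0)) ⟩
  2 * ∑ m 0 (energy h) + length (subsets m 0) * 2 + ∑ m 1 (energy h)
    ≤⟨ +-mono-≤ (+-mono-≤ (*-monoʳ-≤ 2 (∑-energy≤ h 0)) (≤-reflexive (cong (_* 2) (length-subsets m 0)))) (∑-energy≤ h 1) ⟩
  2 * 0 + (m C 0) * 2 + 1 * (m C 1)
    ≡⟨ regroup (m C 0) (m C 1) ⟩
  1 * (m C 0 + (m C 0 + m C 1))
    ≡⟨ cong (1 *_) (cong₂ _+_ (trans (nC0≡1 m) (sym (nC0≡1 (1 + m)))) (nCk+nC[k+1]≡[n+1]C[k+1] m 0)) ⟩
  1 * (suc m C 0 + suc m C 1)
    ≡⟨ cong (1 *_) (nCk+nC[k+1]≡[n+1]C[k+1] (suc m) 0) ⟩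
  1 * ((2 + m) C 1) ∎
  where
  open ≤-Reasoning
  m = h * 2
  regroup : ∀ a b → 2 * 0 + a * 2 + 1 * b ≡ 1 * (a + (a + b))
  regroup = solve-∀
∑-energy≤ (suc h) (suc (suc t)) = begin
  ∑ (2 + m) (2 + t) (energy (suc h))
    ≡⟨ trans (∑-suc (1 + m) (1 + t) _) (cong₂ _+_ (∑-suc m t _) (∑-suc m (1 + t) _)) ⟩
  ∑ m t (energy h) + ∑ m (1 + t) (λ e → sq (1ℤ ℤ.+ imbalance h e))
    + (∑ m (1 + t) (λ e → sq (-1ℤ ℤ.+ imbalance h e)) + ∑ m (2 + t) (energy h))
    ≡⟨ reassoc (∑ m t _) (∑ m (1 + t) _) _ _ ⟩
  ∑ m t (energy h) + (∑ m (1 + t) (λ e → sq (1ℤ ℤ.+ imbalance h e))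
    + ∑ m (1 + t) (λ e → sq (-1ℤ ℤ.+ imbalance h e))) + ∑ m (2 + t) (energy h)
    ≡⟨ cong (λ x → ∑ m t (energy h) + x + ∑ m (2 + t) (energy h)) (sum-parallelogram h (subsets m (1 + t))) ⟩
  ∑ m t (energy h) + (2 * ∑ m (1 + t) (energy h) + length (subsets m (1 + t)) * 2) + ∑ m (2 + t) (energy h)
    ≤⟨ +-mono-≤ (+-mono-≤ (∑-energy≤ h t) (+-mono-≤ (*-monoʳ-≤ 2 (∑-energy≤ h (1 + t)))
         (≤-reflexive (cong (_* 2) (length-subsets m (1 + t)))))) (∑-energy≤ h (2 + t)) ⟩
  t * x + (2 * ((1 + t) * y) + y * 2) + (2 + t) * z
    -- Subsets containing the whole pair come with the factor `t` only. The slack `2 * x` raises it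
    -- to `2 + t`, after which Pascal's rule applies twice.
    ≤⟨ m≤m+n _ (2 * x) ⟩
  t * x + (2 * ((1 + t) * y) + y * 2) + (2 + t) * z + 2 * x
    ≡⟨ regroup t x y z ⟩
  (2 + t) * (x + y + (y + z))
    ≡⟨ cong ((2 + t) *_) (cong₂ _+_ (nCk+nC[k+1]≡[n+1]C[k+1] m t) (nCk+nC[k+1]≡[n+1]C[k+1] m (1 + t))) ⟩
  (2 + t) * (suc m C suc t + suc m C (2 + t))
    ≡⟨ cong ((2 + t) *_) (nCk+nC[k+1]≡[n+1]C[k+1] (suc m) (suc t)) ⟩
  (2 + t) * ((2 + m) C (2 + t)) ∎
  where
  open ≤-Reasoning
  m = h * 2
  x = m C t
  y = m C (1 + t)
  z = m C (2 + t)
  reassoc : ∀ a b c d → a + b + (c + d) ≡ a + (b + c) + d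
  reassoc = solve-∀
  regroup : ∀ t x y z → t * x + (2 * ((1 + t) * y) + y * 2) + (2 + t) * z + 2 * x ≡ (2 + t) * (x + y + (y + z))
  regroup = solve-∀

-- Alternating degree sequences

-- The length is `h * 2` because `suc h * 2` reduces to `suc (suc (h * 2))`: recursion on `h` peels
-- off one high and one low position.
alternatingSum : ∀ h → (Fin (h * 2) → ℕ) → ℤ
alternatingSum zero    f = 0ℤ
alternatingSum (suc h) f = + f zero ℤ.- + f (suc zero) ℤ.+ alternatingSum h (λ i → f (suc (suc i)))

alternatingSum-cong : ∀ h {f g} → (∀ i → f i ≡ g i) → alternatingSum h f ≡ alternatingSum h g
alternatingSum-cong zero    f≗g = refl
alternatingSum-cong (suc h) f≗g =
  cong₂ ℤ._+_ (cong₂ (λ m n → + m ℤ.- + n) (f≗g _) (f≗g _)) (alternatingSum-cong h (λ i → f≗g (suc (suc i))))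

alternatingSum-0 : ∀ h → alternatingSum h (λ _ → 0) ≡ 0ℤ
alternatingSum-0 zero    = refl
alternatingSum-0 (suc h) = trans (ℤₚ.+-identityˡ _) (alternatingSum-0 h)

alternatingSum-+ : ∀ h f g → alternatingSum h (λ i → f i + g i) ≡ alternatingSum h f ℤ.+ alternatingSum h g
alternatingSum-+ zero    f g = refl
alternatingSum-+ (suc h) f g =
  trans (cong (ℤ._+_ (+ (f zero + g zero) ℤ.- + (f (suc zero) + g (suc zero))))
              (alternatingSum-+ h (λ i → f (suc (suc i))) (λ i → g (suc (suc i)))))
        (regroup (+ f zero) (+ f (suc zero)) (+ g zero) (+ g (suc zero)) _ _)
  where
  regroup : ∀ a b c d x y → a ℤ.+ c ℤ.- (b ℤ.+ d) ℤ.+ (x ℤ.+ y) ≡ a ℤ.- b ℤ.+ x ℤ.+ (c ℤ.- d ℤ.+ y)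
  regroup = ℤ-Ring.solve-∀

-- `degree` for a bare list of edges, which permits induction on that list; `degree H` unfolds to
-- it.
degreeIn : ∀ {n} → List (Subset n) → Fin n → ℕ
degreeIn es v = length (filter (v ∈?_) es)

degreeIn-∷ : ∀ {n} e (es : List (Subset n)) v → degreeIn (e ∷ es) v ≡ degreeIn (e ∷ []) v + degreeIn es v
degreeIn-∷ e es v = trans (cong length (filter-++ (v ∈?_) (e ∷ []) es)) (length-++ (filter (v ∈?_) (e ∷ [])))

degreeIn-suc : ∀ {n} s (e : Subset n) v → degreeIn ((s ∷ e) ∷ []) (suc v) ≡ degreeIn (e ∷ []) v
degreeIn-suc s e v with does (v ∈? e)
... | false = refl
... | true  = refl

-- A single edge gives degree 1 to its own vertices and 0 to the others, so the signs of its
-- vertices are what is summed.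
alternatingSum-degreeIn : ∀ h e → alternatingSum h (degreeIn (e ∷ [])) ≡ imbalance h e
alternatingSum-degreeIn zero    []          = refl
alternatingSum-degreeIn (suc h) (a ∷ b ∷ e) = begin
  x ℤ.+ alternatingSum h (λ i → degreeIn ((a ∷ b ∷ e) ∷ []) (suc (suc i)))
    ≡⟨ cong (ℤ._+_ x) (alternatingSum-cong h (λ i → trans (degreeIn-suc a (b ∷ e) (suc i)) (degreeIn-suc b e i))) ⟩
  x ℤ.+ alternatingSum h (degreeIn (e ∷ []))
    ≡⟨ cong₂ ℤ._+_ (cong (λ m → + degreeIn ((a ∷ b ∷ e) ∷ []) zero ℤ.- + m) (degreeIn-suc a (b ∷ e) zero)) (alternatingSum-degreeIn h e) ⟩
  + degreeIn ((a ∷ b ∷ e) ∷ []) zero ℤ.- + degreeIn ((b ∷ e) ∷ []) zero ℤ.+ imbalance h e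
    ≡⟨ head a b ⟩
  imbalance (suc h) (a ∷ b ∷ e) ∎
  where
  open ≡-Reasoning
  x = + degreeIn ((a ∷ b ∷ e) ∷ []) zero ℤ.- + degreeIn ((a ∷ b ∷ e) ∷ []) (suc zero)
  head : ∀ a b → + degreeIn ((a ∷ b ∷ e) ∷ []) zero ℤ.- + degreeIn ((b ∷ e) ∷ []) zero ℤ.+ imbalance h e
               ≡ imbalance (suc h) (a ∷ b ∷ e)
  head inside  inside  = ℤₚ.+-identityˡ (imbalance h e)
  head inside  outside = refl
  head outside inside  = refl
  head outside outside = ℤₚ.+-identityˡ (imbalance h e)

-- The difference of the two sides is the square of `i - L`.
2ab≤a²+b² : ∀ L i → + (2 * L) ℤ.* i ℤ.≤ + (sq i + L * L)
2ab≤a²+b² L i = ℤₚ.0≤i-j⇒j≤i (subst (ℤ._≤_ 0ℤ) (begin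
  + sq (i ℤ.- + L)                                       ≡⟨ +sq (i ℤ.- + L) ⟩
  (i ℤ.- + L) ℤ.* (i ℤ.- + L)                            ≡⟨ expand (+ L) i ⟩
  i ℤ.* i ℤ.+ + L ℤ.* + L ℤ.- + 2 ℤ.* + L ℤ.* i          ≡⟨ cong₂ (λ x y → x ℤ.- y ℤ.* i) (cong₂ ℤ._+_ (+sq i) (ℤₚ.pos-* L L)) (ℤₚ.pos-* 2 L) ⟨
  + sq i ℤ.+ + (L * L) ℤ.- + (2 * L) ℤ.* i               ≡⟨ cong (λ x → x ℤ.- + (2 * L) ℤ.* i) (ℤₚ.pos-+ (sq i) (L * L)) ⟨
  + (sq i + L * L) ℤ.- + (2 * L) ℤ.* i                   ∎) (ℤ.+≤+ z≤n))
  where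
  open ≡-Reasoning
  expand : ∀ l i → (i ℤ.- l) ℤ.* (i ℤ.- l) ≡ i ℤ.* i ℤ.+ l ℤ.* l ℤ.- + 2 ℤ.* l ℤ.* i
  expand = ℤ-Ring.solve-∀

-- Signed double counting: the alternating sum of the degrees is the sum of the imbalances of the
-- edges. Each imbalance may be negative, whereas the quadratic bound put in its place is a natural
-- number.
alternatingSum-degreeIn≤ : ∀ h L es →
  + (2 * L) ℤ.* alternatingSum h (degreeIn es) ℤ.≤ + sum (map (λ e → energy h e + L * L) es)
alternatingSum-degreeIn≤ h L []       =
  ℤₚ.≤-reflexive (trans (cong (ℤ._*_ (+ (2 * L))) (alternatingSum-0 h)) (ℤₚ.*-zeroʳ (+ (2 * L))))
alternatingSum-degreeIn≤ h L (e ∷ es) = begin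
  + (2 * L) ℤ.* alternatingSum h (degreeIn (e ∷ es))
    ≡⟨ cong (ℤ._*_ (+ (2 * L))) (trans (alternatingSum-cong h (degreeIn-∷ e es)) (alternatingSum-+ h (degreeIn (e ∷ [])) (degreeIn es))) ⟩
  + (2 * L) ℤ.* (alternatingSum h (degreeIn (e ∷ [])) ℤ.+ alternatingSum h (degreeIn es))
    ≡⟨ ℤₚ.*-distribˡ-+ (+ (2 * L)) (alternatingSum h (degreeIn (e ∷ []))) _ ⟩
  + (2 * L) ℤ.* alternatingSum h (degreeIn (e ∷ [])) ℤ.+ + (2 * L) ℤ.* alternatingSum h (degreeIn es)
    ≡⟨ cong (λ x → + (2 * L) ℤ.* x ℤ.+ + (2 * L) ℤ.* alternatingSum h (degreeIn es)) (alternatingSum-degreeIn h e) ⟩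
  + (2 * L) ℤ.* imbalance h e ℤ.+ + (2 * L) ℤ.* alternatingSum h (degreeIn es)
    ≤⟨ ℤₚ.+-mono-≤ (2ab≤a²+b² L (imbalance h e)) (alternatingSum-degreeIn≤ h L es) ⟩
  + (energy h e + L * L) ℤ.+ + sum (map (λ e → energy h e + L * L) es)
    ≡⟨ ℤₚ.pos-+ (energy h e + L * L) _ ⟨
  + sum (map (λ e → energy h e + L * L) (e ∷ es)) ∎
  where open ℤₚ.≤-Reasoning

alternating : ∀ h → ℕ → ℕ → Vec ℕ (h * 2)
alternating zero    x y = []
alternating (suc h) x y = x ∷ y ∷ alternating h x y

alternatingSum-alternating : ∀ h l d → alternatingSum h (lookup (alternating h (l + d) l)) ≡ + (h * d)
alternatingSum-alternating zero    l d = refl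
alternatingSum-alternating (suc h) l d = begin
  + (l + d) ℤ.- + l ℤ.+ alternatingSum h (lookup (alternating h (l + d) l))
    ≡⟨ cong₂ (λ x y → x ℤ.- + l ℤ.+ y) (ℤₚ.pos-+ l d) (alternatingSum-alternating h l d) ⟩
  + l ℤ.+ + d ℤ.- + l ℤ.+ + (h * d)
    ≡⟨ cancel (+ l) (+ d) _ ⟩
  + d ℤ.+ + (h * d)
    ≡⟨ ℤₚ.pos-+ d (h * d) ⟨
  + (suc h * d) ∎
  where
  open ≡-Reasoning
  cancel : ∀ l d x → l ℤ.+ d ℤ.- l ℤ.+ x ≡ d ℤ.+ x
  cancel = ℤ-Ring.solve-∀

-- Realizations of alternating sequences

sum-energy≤ : ∀ {t} h L (H : UniformHypergraph t (h * 2)) →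
              sum (map (λ e → energy h e + L * L) (UniformHypergraph.edges H)) ≤ (t + L * L) * ((h * 2) C t)
sum-energy≤ {t} h L H = begin
  -- The edges are distinct t-subsets and all terms are nonnegative, so the choice of the edge set
  -- no longer matters.
  sum (map (λ e → energy h e + L * L) edges)                       ≤⟨ sum-map-⊆ _ unique edges⊆subsets ⟩
  ∑ (h * 2) t (λ e → energy h e + L * L)                           ≡⟨ sum-map-+-const (energy h) (L * L) (subsets (h * 2) t) ⟩
  ∑ (h * 2) t (energy h) + length (subsets (h * 2) t) * (L * L)
    ≤⟨ +-mono-≤ (∑-energy≤ h t) (≤-reflexive (cong (_* (L * L)) (length-subsets (h * 2) t))) ⟩
  t * ((h * 2) C t) + ((h * 2) C t) * (L * L)                      ≡⟨ factor t ((h * 2) C t) (L * L) ⟩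
  (t + L * L) * ((h * 2) C t)                                      ∎
  where
  open ≤-Reasoning
  open UniformHypergraph H using (edges; unique; uniform)
  edges⊆subsets : ∀ {e} → e ∈ edges → e ∈ subsets (h * 2) t
  edges⊆subsets {e} e∈ = subst (λ s → e ∈ subsets (h * 2) s) (All.lookup uniform e∈) (∈-subsets e)
  factor : ∀ t c m → t * c + c * m ≡ (t + m) * c
  factor = solve-∀

realization-bound : ∀ {t} h l d L → HasRealization t (alternating h (l + d) l) →
                    2 * L * (h * d) ≤ (t + L * L) * ((h * 2) C t)
realization-bound {t} h l d L (H , deg) = ≤-trans (ℤₚ.drop‿+≤+ (begin
  + (2 * L * (h * d))                                                 ≡⟨ ℤₚ.pos-* (2 * L) (h * d) ⟩
  + (2 * L) ℤ.* + (h * d)                                             ≡⟨ cong (ℤ._*_ (+ (2 * L))) (alternatingSum-alternating h l d) ⟨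
  + (2 * L) ℤ.* alternatingSum h (lookup (alternating h (l + d) l))   ≡⟨ cong (ℤ._*_ (+ (2 * L))) (alternatingSum-cong h deg) ⟨
  + (2 * L) ℤ.* alternatingSum h (degreeIn edges)                     ≤⟨ alternatingSum-degreeIn≤ h L edges ⟩
  + sum (map (λ e → energy h e + L * L) edges)                        ∎)) (sum-energy≤ h L H)
  where
  open ℤₚ.≤-Reasoning
  open UniformHypergraph H using (edges)

-- For `L * L ≤ t` the factor `t + L * L` is at most `2 * t`, absorption yields the number of
-- vertices times `maxDegree`, and the number of vertices cancels.
realization-gap : ∀ {t} h l d L → L * L ≤ suc t → HasRealization (suc t) (alternating (suc h) (l + d) l) →
                  L * d ≤ 2 * maxDegree (suc t) (suc h * 2)
realization-gap {t} h l d L L²≤t real = *-cancelˡ-≤ (2 * suc h) (begin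
  2 * suc h * (L * d)                              ≡⟨ regroup (suc h) L d ⟩
  2 * L * (suc h * d)                              ≤⟨ realization-bound (suc h) l d L real ⟩
  (suc t + L * L) * ((suc h * 2) C suc t)          ≤⟨ *-monoˡ-≤ ((suc h * 2) C suc t) (+-monoʳ-≤ (suc t) L²≤t) ⟩
  (suc t + suc t) * ((suc h * 2) C suc t)          ≡⟨ double (suc t) ((suc h * 2) C suc t) ⟩
  2 * (suc t * ((suc h * 2) C suc t))              ≡⟨ cong (2 *_) (k*nCk≡n*[n-1]C[k-1] (suc (h * 2)) t) ⟩
  2 * (suc h * 2 * (suc (h * 2) C t))              ≡⟨ assoc (suc h) (suc (h * 2) C t) ⟩
  2 * suc h * (2 * (suc (h * 2) C t))              ∎)
  where
  open ≤-Reasoning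
  regroup : ∀ h L d → 2 * h * (L * d) ≡ 2 * L * (h * d)
  regroup = solve-∀
  double : ∀ t c → (t + t) * c ≡ 2 * (t * c)
  double = solve-∀
  assoc : ∀ h k → 2 * (h * 2 * k) ≡ 2 * h * (2 * k)
  assoc = solve-∀

-- Integer degrees in a rational interval

-- `ℕ→ℚ n` normalises by a gcd that is stuck on a variable `n`; `fromℤ` exposes numerator and
-- denominator, so that arithmetic and order compute.
ℕ→ℚ≡fromℤ : ∀ n → ℕ→ℚ n ≡ fromℤ (+ n)
ℕ→ℚ≡fromℤ n = ℚₚ.fromℚᵘ-toℚᵘ (fromℤ (+ n))

ℕ→ℚ-+ : ∀ m n → ℕ→ℚ (m + n) ≡ ℕ→ℚ m ℚ.+ ℕ→ℚ n
ℕ→ℚ-+ m n = begin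
  + (m + n) ℚ./ 1                       ≡⟨ cong₂ (λ i j → (i ℤ.+ j) ℚ./ 1) (ℤₚ.*-identityʳ (+ m)) (ℤₚ.*-identityʳ (+ n)) ⟨
  fromℤ (+ m) ℚ.+ fromℤ (+ n)             ≡⟨ cong₂ ℚ._+_ (ℕ→ℚ≡fromℤ m) (ℕ→ℚ≡fromℤ n) ⟨
  ℕ→ℚ m ℚ.+ ℕ→ℚ n                         ∎
  where open ≡-Reasoning

ℕ→ℚ-suc : ∀ n → ℕ→ℚ (suc n) ≡ ℕ→ℚ n ℚ.+ 1ℚ
ℕ→ℚ-suc n = trans (cong ℕ→ℚ (+-comm 1 n)) (ℕ→ℚ-+ n 1)

ℕ→ℚ-* : ∀ m n → ℕ→ℚ (m * n) ≡ ℕ→ℚ m ℚ.* ℕ→ℚ n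
ℕ→ℚ-* m n = begin
  + (m * n) ℚ./ 1               ≡⟨ cong (λ i → i ℚ./ 1) (ℤₚ.pos-* m n) ⟩
  fromℤ (+ m) ℚ.* fromℤ (+ n)     ≡⟨ cong₂ ℚ._*_ (ℕ→ℚ≡fromℤ m) (ℕ→ℚ≡fromℤ n) ⟨
  ℕ→ℚ m ℚ.* ℕ→ℚ n                 ∎
  where open ≡-Reasoning

ℕ→ℚ-mono-≤ : ∀ {m n} → m ≤ n → ℕ→ℚ m ℚ.≤ ℕ→ℚ n
ℕ→ℚ-mono-≤ {m} {n} m≤n rewrite ℕ→ℚ≡fromℤ m | ℕ→ℚ≡fromℤ n =
  *≤* (ℤₚ.*-monoʳ-≤-nonNeg (+ 1) (ℤ.+≤+ m≤n))

ℕ→ℚ-mono-< : ∀ {m n} → m < n → ℕ→ℚ m ℚ.< ℕ→ℚ n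
ℕ→ℚ-mono-< {m} {n} m<n rewrite ℕ→ℚ≡fromℤ m | ℕ→ℚ≡fromℤ n =
  *<* (ℤₚ.*-monoʳ-<-pos (+ 1) (ℤ.+<+ m<n))

ℕ→ℚ-cancel-≤ : ∀ {m n} → ℕ→ℚ m ℚ.≤ ℕ→ℚ n → m ≤ n
ℕ→ℚ-cancel-≤ p = ≮⇒≥ λ n<m → ℚₚ.<-irrefl refl (ℚₚ.<-≤-trans (ℕ→ℚ-mono-< n<m) p)

-- The denominator of `ε` serves as `q`: the product is then the numerator, a positive integer.
archimedean : ∀ ε → 0ℚ ℚ.< ε → ∃ λ q → 1ℚ ℚ.≤ ε ℚ.* ℕ→ℚ q
archimedean ε@(mkℚ +[1+ n ] d _) 0<ε = suc d , subst (1ℚ ℚ.≤_) numerator (ℕ→ℚ-mono-≤ {1} {suc n} (s≤s z≤n))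
  where
  open ≡-Reasoning
  numerator : ℕ→ℚ (suc n) ≡ ε ℚ.* ℕ→ℚ (suc d)
  numerator = begin
    ℕ→ℚ (suc n)                  ≡⟨ ℚₚ.fromℚᵘ-cong {mkℚᵘ (+ suc n) 0} {mkℚᵘ (+ suc n ℤ.* + suc d) (d * 1)}
                                      (*≡* (trans (cong (λ m → + suc n ℤ.* + suc m) (*-identityʳ d)) (sym (ℤₚ.*-identityʳ (+ suc n ℤ.* + suc d))))) ⟩
    ε ℚ.* fromℤ (+ suc d)        ≡⟨ cong (ε ℚ.*_) (ℕ→ℚ≡fromℤ (suc d)) ⟨
    ε ℚ.* ℕ→ℚ (suc d)            ∎
archimedean (mkℚ +0       d _) 0<ε = contradiction (ℚ.positive 0<ε) λ ()
archimedean (mkℚ -[1+ n ] d _) 0<ε = contradiction (ℚ.positive 0<ε) λ ()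

p≤∣numerator∣ : ∀ p → p ℚ.≤ ℕ→ℚ ℤ.∣ ℚ.↥ p ∣
p≤∣numerator∣ p@(mkℚ (+ n) d _) = subst (p ℚ.≤_) (sym (ℕ→ℚ≡fromℤ n))
  (*≤* (ℤₚ.*-monoˡ-≤-nonNeg (+ n) (ℤ.+≤+ (s≤s z≤n))))
p≤∣numerator∣ p@(mkℚ -[1+ n ] d _) = subst (p ℚ.≤_) (sym (ℕ→ℚ≡fromℤ (suc n))) (*≤* ℤ.-≤+)

-- Downward search from the absolute value of the numerator. If `suc m` is not below `x + 1`, then
-- `m` is still at least `x`; at 0 the search ends because `x` is nonnegative.
ceiling : ∀ x → 0ℚ ℚ.≤ x → ∃ λ m → x ℚ.≤ ℕ→ℚ m × ℕ→ℚ m ℚ.< x ℚ.+ 1ℚ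
ceiling x 0≤x = descend ℤ.∣ ℚ.↥ x ∣ (p≤∣numerator∣ x)
  where
  descend : ∀ m → x ℚ.≤ ℕ→ℚ m → ∃ λ m → x ℚ.≤ ℕ→ℚ m × ℕ→ℚ m ℚ.< x ℚ.+ 1ℚ
  descend zero    x≤0 = 0 , x≤0 , ℚₚ.+-mono-≤-< 0≤x (ℕ→ℚ-mono-< {0} {1} (s≤s z≤n))
  descend (suc m) x≤m+1 with ℕ→ℚ (suc m) ℚₚ.<? x ℚ.+ 1ℚ
  ... | yes m+1<x+1 = suc m , x≤m+1 , m+1<x+1
  ... | no  m+1≮x+1 = descend m (ℚₚ.≮⇒≥ λ m<x →
    m+1≮x+1 (subst (ℚ._< x ℚ.+ 1ℚ) (sym (ℕ→ℚ-suc m)) (ℚₚ.+-monoˡ-< 1ℚ m<x)))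

*-ℕ→ℚ-monoˡ-≤ : ∀ n {x y} → x ℚ.≤ y → x ℚ.* ℕ→ℚ n ℚ.≤ y ℚ.* ℕ→ℚ n
*-ℕ→ℚ-monoˡ-≤ n = ℚₚ.*-monoʳ-≤-nonNeg (ℕ→ℚ n) {{ℚₚ.normalize-nonNeg n 1}}

*-ℕ→ℚ-nonNeg : ∀ n {x} → 0ℚ ℚ.≤ x → 0ℚ ℚ.≤ x ℚ.* ℕ→ℚ n
*-ℕ→ℚ-nonNeg n {x} 0≤x = subst (ℚ._≤ x ℚ.* ℕ→ℚ n) (ℚₚ.*-zeroˡ (ℕ→ℚ n)) (*-ℕ→ℚ-monoˡ-≤ n 0≤x)

-- Replaces `ε` by its lower bound `1/q`, so that the final contradiction takes place in `ℕ`.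
scaled-ceiling : ∀ {ε} q K m → 1ℚ ℚ.≤ ε ℚ.* ℕ→ℚ q → ε ℚ.* ℕ→ℚ K ℚ.≤ ℕ→ℚ m → K ≤ q * m
scaled-ceiling {ε} q K m 1≤εq εK≤m = ℕ→ℚ-cancel-≤ (begin
  ℕ→ℚ K                          ≡⟨ ℚₚ.*-identityˡ (ℕ→ℚ K) ⟨
  1ℚ ℚ.* ℕ→ℚ K                   ≤⟨ *-ℕ→ℚ-monoˡ-≤ K 1≤εq ⟩
  ε ℚ.* ℕ→ℚ q ℚ.* ℕ→ℚ K          ≡⟨ rearrange ε (ℕ→ℚ q) (ℕ→ℚ K) ⟩
  ε ℚ.* ℕ→ℚ K ℚ.* ℕ→ℚ q          ≤⟨ *-ℕ→ℚ-monoˡ-≤ q εK≤m ⟩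
  ℕ→ℚ m ℚ.* ℕ→ℚ q                ≡⟨ ℕ→ℚ-* m q ⟨
  ℕ→ℚ (m * q)                    ≡⟨ cong ℕ→ℚ (*-comm m q) ⟩
  ℕ→ℚ (q * m)                    ∎)
  where
  open ℚₚ.≤-Reasoning
  open ℚ-Solver.+-*-Solver
  rearrange : ∀ a b c → a ℚ.* b ℚ.* c ≡ a ℚ.* c ℚ.* b
  rearrange = solve 3 (λ a b c → a :* b :* c := a :* c :* b) refl

-- Two ceilings overshoot by less than 1 each; lowering one of them by 2 pays for both.
+-drop-2 : ∀ l d {x y} → ℕ→ℚ l ℚ.< x ℚ.+ 1ℚ → ℕ→ℚ (2 + d) ℚ.< y ℚ.+ 1ℚ → ℕ→ℚ (l + d) ℚ.≤ x ℚ.+ y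
+-drop-2 l d {x} {y} l<x+1 d+2<y+1 = begin
  ℕ→ℚ (l + d)                                         ≡⟨ ℕ→ℚ-+ l d ⟩
  ℕ→ℚ l ℚ.+ ℕ→ℚ d                                     ≡⟨ add-2 (ℕ→ℚ l) (ℕ→ℚ d) ⟩
  ℕ→ℚ l ℚ.+ (ℕ→ℚ d ℚ.+ 1ℚ ℚ.+ 1ℚ) ℚ.- (1ℚ ℚ.+ 1ℚ)
    ≡⟨ cong (λ z → ℕ→ℚ l ℚ.+ z ℚ.- (1ℚ ℚ.+ 1ℚ)) (trans (ℕ→ℚ-suc (suc d)) (cong (ℚ._+ 1ℚ) (ℕ→ℚ-suc d))) ⟨
  ℕ→ℚ l ℚ.+ ℕ→ℚ (2 + d) ℚ.- (1ℚ ℚ.+ 1ℚ)               ≤⟨ ℚₚ.+-monoˡ-≤ (ℚ.- (1ℚ ℚ.+ 1ℚ)) (ℚₚ.+-mono-≤ (ℚₚ.<⇒≤ l<x+1) (ℚₚ.<⇒≤ d+2<y+1)) ⟩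
  (x ℚ.+ 1ℚ) ℚ.+ (y ℚ.+ 1ℚ) ℚ.- (1ℚ ℚ.+ 1ℚ)           ≡⟨ remove-2 x y ⟩
  x ℚ.+ y                                             ∎
  where
  open ℚₚ.≤-Reasoning
  open ℚ-Solver.+-*-Solver
  add-2 : ∀ x y → x ℚ.+ y ≡ x ℚ.+ (y ℚ.+ 1ℚ ℚ.+ 1ℚ) ℚ.- (1ℚ ℚ.+ 1ℚ)
  add-2 = solve 2 (λ x y → x :+ y := x :+ (y :+ con 1ℚ :+ con 1ℚ) :- con (1ℚ ℚ.+ 1ℚ)) refl
  remove-2 : ∀ x y → (x ℚ.+ 1ℚ) ℚ.+ (y ℚ.+ 1ℚ) ℚ.- (1ℚ ℚ.+ 1ℚ) ≡ x ℚ.+ y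
  remove-2 = solve 2 (λ x y → (x :+ con 1ℚ) :+ (y :+ con 1ℚ) :- con (1ℚ ℚ.+ 1ℚ) := x :+ y) refl

scaled-gap : ∀ {ε r s} K → ε ℚ.< r ℚ.- s → s ℚ.* ℕ→ℚ K ℚ.+ ε ℚ.* ℕ→ℚ K ℚ.≤ r ℚ.* ℕ→ℚ K
scaled-gap {ε} {r} {s} K ε<r-s = begin
  s ℚ.* ℕ→ℚ K ℚ.+ ε ℚ.* ℕ→ℚ K      ≡⟨ ℚₚ.*-distribʳ-+ (ℕ→ℚ K) s ε ⟨
  (s ℚ.+ ε) ℚ.* ℕ→ℚ K              ≤⟨ *-ℕ→ℚ-monoˡ-≤ K (ℚₚ.+-monoʳ-≤ s (ℚₚ.<⇒≤ ε<r-s)) ⟩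
  (s ℚ.+ (r ℚ.- s)) ℚ.* ℕ→ℚ K      ≡⟨ cong (ℚ._* ℕ→ℚ K) (cancel r s) ⟩
  r ℚ.* ℕ→ℚ K                      ∎
  where
  open ℚₚ.≤-Reasoning
  open ℚ-Solver.+-*-Solver
  cancel : ∀ r s → s ℚ.+ (r ℚ.- s) ≡ r
  cancel = solve 2 (λ r s → s :+ (r :- s) := r) refl

-- `l` is the ceiling of `s K`, and `d` is the ceiling of `ε K` less 2, to make up for the rounding.
integers-between : ∀ {ε r s} q K → 0ℚ ℚ.< ε → 0ℚ ℚ.≤ s → ε ℚ.< r ℚ.- s → 1ℚ ℚ.≤ ε ℚ.* ℕ→ℚ q → q < K →
  ∃₂ λ l d → s ℚ.* ℕ→ℚ K ℚ.≤ ℕ→ℚ l × ℕ→ℚ (l + d) ℚ.≤ r ℚ.* ℕ→ℚ K × K ≤ q * (2 + d)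
integers-between {ε} {r} {s} q K 0<ε 0≤s ε<r-s 1≤εq q<K =
  assemble (ceiling (s ℚ.* ℕ→ℚ K) (*-ℕ→ℚ-nonNeg K 0≤s)) (ceiling (ε ℚ.* ℕ→ℚ K) (*-ℕ→ℚ-nonNeg K (ℚₚ.<⇒≤ 0<ε)))
  where
  Ceiling : ℚ → Set
  Ceiling x = ∃ λ m → x ℚ.≤ ℕ→ℚ m × ℕ→ℚ m ℚ.< x ℚ.+ 1ℚ
  assemble : Ceiling (s ℚ.* ℕ→ℚ K) → Ceiling (ε ℚ.* ℕ→ℚ K) →
    ∃₂ λ l d → s ℚ.* ℕ→ℚ K ℚ.≤ ℕ→ℚ l × ℕ→ℚ (l + d) ℚ.≤ r ℚ.* ℕ→ℚ K × K ≤ q * (2 + d)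
  -- Subtracting 2 requires a ceiling of at least 2: the values 0 and 1 would give `K ≤ q`.
  assemble _                    (0 , εK≤0 , _) = contradiction
    (<-≤-trans q<K (≤-trans (scaled-ceiling {ε} q K 0 1≤εq εK≤0) (*-monoʳ-≤ q {0} {1} z≤n))) (≤⇒≯ (≤-reflexive (*-identityʳ q)))
  assemble _                    (1 , εK≤1 , _) = contradiction
    (<-≤-trans q<K (scaled-ceiling {ε} q K 1 1≤εq εK≤1)) (≤⇒≯ (≤-reflexive (*-identityʳ q)))
  assemble (l , sK≤l , l<sK+1) (suc (suc d) , εK≤m , m<εK+1) =
    l , d , sK≤l
      , ℚₚ.≤-trans (+-drop-2 l d {s ℚ.* ℕ→ℚ K} {ε ℚ.* ℕ→ℚ K} l<sK+1 m<εK+1) (scaled-gap {ε} {r} {s} K ε<r-s)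
      , scaled-ceiling {ε} q K (2 + d) 1≤εq εK≤m

-- Always graphic intervals

-- With `≤ᴿ-·`, reduces bounds by reals to bounds by rationals on the safe side: `s` above `a` and
-- `r` below `b`.
·-≤ᴿ : ∀ x {s} K l → Upper x s → s ℚ.* ℕ→ℚ K ℚ.≤ ℕ→ℚ l → x · K ≤ᴿ fromℕ l
·-≤ᴿ x K l xs sK≤l p (r , xr , p<rK) =
  ℚₚ.<-≤-trans p<rK (ℚₚ.≤-trans (*-ℕ→ℚ-monoˡ-≤ K (ℚₚ.<⇒≤ (separated x xr xs))) sK≤l)

≤ᴿ-· : ∀ x {r} K m → Lower x r → ℕ→ℚ m ℚ.≤ r ℚ.* ℕ→ℚ K → fromℕ m ≤ᴿ x · K
≤ᴿ-· x K m xr m≤rK p p<m = _ , xr , ℚₚ.<-≤-trans p<m m≤rK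

upper-nonNeg : ∀ x {s} → fromℕ 0 ≤ᴿ x → Upper x s → 0ℚ ℚ.≤ s
upper-nonNeg x {s} 0≤x xs = ℚₚ.≮⇒≥ λ s<0 → ℚₚ.<-irrefl refl (separated x (0≤x s s<0) xs)

lookup-alternating : ∀ {P : ℕ → Set} h {x y} → P x → P y → ∀ i → P (lookup (alternating h x y) i)
lookup-alternating (suc h) px py zero          = px
lookup-alternating (suc h) px py (suc zero)    = py
lookup-alternating {P} (suc h) px py (suc (suc i)) = lookup-alternating {P} h px py i

sum-alternating : ∀ h x y → Vec.sum (alternating h x y) ≡ h * (x + y)
sum-alternating zero    x y = refl
sum-alternating (suc h) x y = trans (cong (λ z → x + (y + z)) (sum-alternating h x y)) (sym (+-assoc x y _))

-- The uniformity is at least 2 here; for uniformity 1 the maximum degree stays at 1.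
maxDegree-grows : ∀ k j {n} → 2 + k + j ≤ n → j < maxDegree (2 + k) n
maxDegree-grows k j {suc n} (s≤s k+1+j≤n) = begin-strict
  j                                        ≤⟨ m+n≤o⇒m≤o∸n j (≤-trans (≤-reflexive (+-comm j (suc k))) k+1+j≤n) ⟩
  n ∸ suc k                                <⟨ nC[k+1]-grows k (n ∸ suc k) ⟩
  (suc k + (n ∸ suc k)) C suc k            ≡⟨ cong (_C suc k) (m+[n∸m]≡n (m+n≤o⇒m≤o (suc k) k+1+j≤n)) ⟩
  n C suc k                                ∎
  where open ≤-Reasoning

-- With `L = 3 * q` the factor 3 beats the factor 2 of `realization-gap`; the surplus `K` absorbs
-- the rounding loss `6 * q`.
gap-too-wide : ∀ q d K → 6 * q < K → K ≤ q * (2 + d) → ¬ 3 * q * d ≤ 2 * K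
gap-too-wide q d K 6q<K K≤q[2+d] 3qd≤2K = <-irrefl refl (begin-strict
  3 * K                  ≤⟨ *-monoʳ-≤ 3 K≤q[2+d] ⟩
  3 * (q * (2 + d))      ≡⟨ expand q d ⟩
  6 * q + 3 * q * d      <⟨ +-mono-<-≤ 6q<K 3qd≤2K ⟩
  K + 2 * K              ∎)
  where
  open ≤-Reasoning
  expand : ∀ q d → 3 * (q * (2 + d)) ≡ 6 * q + 3 * q * d
  expand = solve-∀

module _ {k} (I : AlwaysGraphicInterval (suc k)) where
  open AlwaysGraphicInterval I

  -- In an interval wider than `ε` an alternating sequence fits whose gap `d` satisfies
  -- `K ≤ q * (2 + d)`. Its realization contradicts `realization-gap` for `L = 3 * q`.
  not-wide : ∀ {ε} q h → 0ℚ ℚ.< ε → 1ℚ ℚ.≤ ε ℚ.* ℕ→ℚ q → 3 * q * (3 * q) ≤ suc k →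
    6 * q < maxDegree (suc k) (suc h * 2) → suc k ∣ suc h → proj₁ alwaysGraphic ≤ suc h * 2 →
    ¬ Lower width ε
  not-wide {ε} q h 0<ε 1≤εq 9q²≤t 6q<K t∣h N≤n (r , s , br , as , ε<r-s) = contra
    (integers-between {ε} {r} {s} q K 0<ε (upper-nonNeg a 0≤a as) ε<r-s 1≤εq (≤-<-trans (m≤m+n q (5 * q)) 6q<K))
    where
    K = maxDegree (suc k) (suc h * 2)
    contra : ¬ (∃₂ λ l d → s ℚ.* ℕ→ℚ K ℚ.≤ ℕ→ℚ l × ℕ→ℚ (l + d) ℚ.≤ r ℚ.* ℕ→ℚ K × K ≤ q * (2 + d))
    contra (l , d , sK≤l , l+d≤rK , K≤q[2+d]) =
      gap-too-wide q d K 6q<K K≤q[2+d] (realization-gap h l d (3 * q) 9q²≤t realization)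
      where
      l≤l+d : ℕ→ℚ l ℚ.≤ ℕ→ℚ (l + d)
      l≤l+d = ℕ→ℚ-mono-≤ (m≤m+n l d)
      realization : HasRealization (suc k) (alternating (suc h) (l + d) l)
      realization = proj₂ alwaysGraphic (suc h * 2) N≤n (alternating (suc h) (l + d) l)
        (lookup-alternating {λ x → a · K ≤ᴿ fromℕ x × fromℕ x ≤ᴿ b · K} (suc h)
          (·-≤ᴿ a K (l + d) as (ℚₚ.≤-trans sK≤l l≤l+d) , ≤ᴿ-· b K (l + d) br l+d≤rK)
          (·-≤ᴿ a K l as sK≤l , ≤ᴿ-· b K l br (ℚₚ.≤-trans l≤l+d l+d≤rK)))
        -- The degree sum is a multiple of `suc h`, hence of the uniformity, whatever `l` and `d`
        -- are.
        (subst (suc k ∣_) (sym (sum-alternating (suc h) (l + d) l)) (∣m⇒∣m*n (l + d + l) t∣h))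

-- Each interval has its own threshold `N`, so the number of vertices is chosen after the interval.
-- The condition on the uniformity involves only `q`, which makes it work for the supremum.
maxWidth≤ : ∀ {ε} q k → 0ℚ ℚ.< ε → 1ℚ ℚ.≤ ε ℚ.* ℕ→ℚ q → 3 * q * (3 * q) ≤ 2 + k → ¬ maxWidth (2 + k) ε
maxWidth≤ q k 0<ε 1≤εq 9q²≤t (I , ε<width) =
  -- The successor of this `h` is `(2 + k) * suc j`, a multiple of the uniformity. The summands of
  -- `j` push the maximum degree above `6 * q` and the number of vertices above `N`.
  not-wide I q (j + (1 + k) * suc j) 0<ε 1≤εq 9q²≤t
    (<-≤-trans (s≤s (m≤m+n (6 * q) N)) (maxDegree-grows k j t+j≤n))
    (m∣m*n (suc j))
    (≤-trans (≤-trans (m≤n+m N (6 * q)) (m≤n+m j (2 + k))) t+j≤n)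
    ε<width
  where
  open ≤-Reasoning
  N = proj₁ (AlwaysGraphicInterval.alwaysGraphic I)
  j = 6 * q + N
  t+j≤n : 2 + k + j ≤ (2 + k) * suc j * 2
  t+j≤n = begin
    2 + k + j              ≤⟨ +-monoʳ-≤ (2 + k) (m≤m+n j ((1 + k) * j)) ⟩
    2 + k + (2 + k) * j    ≡⟨ *-suc (2 + k) j ⟨
    (2 + k) * suc j        ≤⟨ m≤m*n ((2 + k) * suc j) 2 ⟩
    (2 + k) * suc j * 2    ∎

-- Shows that the supremum is over an inhabited family: only the zero sequence lies in `[0,0]`, and
-- the empty hypergraph realizes it.
zeroInterval : ∀ t → AlwaysGraphicInterval t
zeroInterval t = record
  { a             = fromℕ 0
  ; b             = fromℕ 0
  ; 0≤a           = λ _ p<0 → p<0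
  ; a≤b           = λ _ p<0 → p<0
  ; b≤1           = λ _ p<0 → ℚₚ.<-trans p<0 (ℕ→ℚ-mono-< {0} {1} (s≤s z≤n))
  ; alwaysGraphic = 0 , λ n _ D bounds _ →
      record { edges = [] ; unique = [] ; uniform = [] } ,
      λ i → sym (≤0·⇒≡0 (maxDegree t n) (lookup D i) (proj₂ (bounds i)))
  }
  where
  ≤0·⇒≡0 : ∀ K m → fromℕ m ≤ᴿ fromℕ 0 · K → m ≡ 0
  ≤0·⇒≡0 K zero    _ = refl
  -- Testing the cuts at 0 gives some `r < 0` with `0 < r K`.
  ≤0·⇒≡0 K (suc m) m≤0 with m≤0 0ℚ (ℕ→ℚ-mono-< {0} {suc m} (s≤s z≤n))
  ... | r , r<0 , 0<rK = contradiction (ℚₚ.<-≤-trans 0<rK (ℚₚ.≤-trans (*-ℕ→ℚ-monoˡ-≤ K (ℚₚ.<⇒≤ r<0))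
                           (ℚₚ.≤-reflexive (ℚₚ.*-zeroˡ (ℕ→ℚ K))))) (ℚₚ.<-irrefl refl)

0≤maxWidth : ∀ t {ε} → 0ℚ ℚ.< ε → maxWidth t (ℚ.- ε)
0≤maxWidth t {ε} 0<ε with ℚₚ.<-dense (ℚₚ.neg-antimono-< 0<ε)
... | p , -ε<p , p<0 with ℚₚ.<-dense -ε<p
-- The width 0 is approximated from below by `p - (p - p′) = p′`, where `p` is below the right end 0
-- and `p - p′` above the left end 0.
...   | p′ , -ε<p′ , p′<p = zeroInterval t , p , p ℚ.- p′ , p<0
  , subst (ℚ._< p ℚ.- p′) (ℚₚ.+-inverseʳ p′) (ℚₚ.+-monoˡ-< (ℚ.- p′) p′<p)
  , subst (ℚ.- ε ℚ.<_) (cancel p p′) -ε<p′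
  where
  open ℚ-Solver.+-*-Solver
  cancel : ∀ p p′ → p′ ≡ p ℚ.- (p ℚ.- p′)
  cancel = solve 2 (λ p p′ → p′ := p :- (p :- p′)) refl

corollary5p2 : TendsToZero maxWidth
corollary5p2 ε 0<ε with archimedean ε 0<ε
-- The summand `3 * q * (3 * q)` admits `L = 3 * q` in `realization-gap`; the 2 ensures that the
-- maximum degree grows with the number of vertices.
... | q , 1≤εq = 2 + 3 * q * (3 * q) , λ where
  (suc (suc k)) (s≤s (s≤s T≤k)) → 0≤maxWidth (2 + k) 0<ε , maxWidth≤ q k 0<ε 1≤εq (≤-trans T≤k (m≤n+m k 2))
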